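{- Let $G$ be a finite simple graph and $k\ge 0$ an integer. If $Z_k(G)\le k$, then $Z_k(G)=Z(G)$.
   Context: Filling rule: if a filled vertex has exactly one unfilled neighbor (and any number of filled neighbors), that neighbor becomes filled; "applying the filling rule in a subgraph $H$" means applying it with neighborhoods taken in $H$. The $Z_q$-Game on $G$ ($q\ge 0$ an integer): initially all vertices are unfilled; a player repeatedly performs one of the following operations until all vertices are filled: (1) for one token, change any vertex from unfilled to filled; (2) at no cost, apply the filling rule in $G$; (3) if $F$ is the current set of filled vertices and $U_1,\dots,U_k$ are the vertex sets of the connected components of $G[V(G)\setminus F]$ with $k\ge q+1$, the player announces a selection of at least $q+1$ of the $U_i$ to an oracle (an adversary), the oracle returns a nonempty subset $\{U_{i_1},\dots,U_{i_\ell}\}$ of the selected components, and the player may at no cost apply the filling rule in $G[F\cup U_{i_1}\cup\cdots\cup U_{i_\ell}]$. $Z_q(G)$ is the minimum number of tokens with which the player can guarantee that all vertices become filled, regardless of the oracle's responses. The $Z$-Game is the same game with only operations (1) and (2) allowed, and $Z(G)$ (the zero forcing number) is the minimum number of tokens needed there to fill all vertices. -}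

module Defs where

open import Data.Empty using (⊥-elim)
open import Data.Fin using (Fin)
open import Data.Fin.Properties using (any?; all?; _≟_; ¬∀⟶∃¬)
open import Data.Fin.Subset using (Subset; _∈_; _∉_; _∪_; _⊃_; ∁; ⊤; ⊥; ⁅_⁆; ⋃; inside; outside)
open import Data.Fin.Subset.Induction using (⊃-wellFounded)
open import Data.Fin.Subset.Properties
  using (_∈?_; p⊆p∪q; q⊆p∪q; x∈⁅x⁆; x∈⁅y⁆⇒x≡y; x∈p∪q⁻)
open import Data.List using (List; []; _∷_; _++_; map; filter; length)
open import Data.List.Relation.Binary.Sublist.Propositional using (_⊆_; []; _∷_; _∷ʳ_)
open import Data.Nat using (ℕ; zero; suc; _<_; _≤_; z≤n; s≤s; _<?_)
open import Data.Product using (∃; _×_; _,_; proj₁; proj₂)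
open import Data.Sum using (_⊎_; inj₁; inj₂; [_,_])
open import Data.Vec using ([]; _∷_)
open import Function using (_∘_; _⇔_; mk⇔; Equivalence)
open import Level using (0ℓ)
open import Induction.WellFounded using (Acc; acc)
open import Relation.Binary using (Rel; Decidable; Symmetric; Irreflexive)
open import Relation.Binary.Construct.Closure.ReflexiveTransitive using (Star; ε; _◅_; _◅◅_)
open import Relation.Binary.PropositionalEquality using (_≡_; _≢_; refl; sym; subst)
open import Relation.Nullary using (¬_; Dec; yes; no; contradiction)
open import Relation.Nullary.Decidable as Dec using (¬?; _×-dec_; _⊎-dec_; _→-dec_)
open import Relation.Unary as Unary using (Pred)


private
  variable
    n : ℕ

record SimpleGraph (n : ℕ) : Set₁ where
  field
    Adj       : Rel (Fin n) 0ℓ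
    Adj?      : Decidable Adj
    symmetric : Symmetric Adj
    loopless  : Irreflexive _≡_ Adj

module _ (G : SimpleGraph n) where
  open SimpleGraph G

  -- Induced subgraphs G[W] are not formed as separate graphs: AdjIn W is
  -- the adjacency relation of G[W].
  AdjIn : Subset n → Rel (Fin n) 0ℓ
  AdjIn W x y = x ∈ W × y ∈ W × Adj x y

  IsComponent : Subset n → Subset n → Set
  IsComponent W U = ∃ λ u → u ∈ W × (∀ v → v ∈ U ⇔ Star (AdjIn W) u v)

  -- With filled set F, the filling rule in G[W] lets x fill y.
  Forces : Subset n → Subset n → Rel (Fin n) 0ℓ
  Forces W F x y = x ∈ F × AdjIn W x y × y ∉ F × (∀ z → AdjIn W x z → z ∉ F → z ≡ y)

  data FillIn (W : Subset n) : Rel (Subset n) 0ℓ where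
    fill : ∀ {F} x y → Forces W F x y → FillIn W F (F ∪ ⁅ y ⁆)

  adjIn? : ∀ W → Decidable (AdjIn W)
  adjIn? W x y = x ∈? W ×-dec y ∈? W ×-dec Adj? x y

  forces? : ∀ W F → Decidable (Forces W F)
  forces? W F x y =
    x ∈? F ×-dec adjIn? W x y ×-dec ¬? (y ∈? F)
      ×-dec all? (λ z → adjIn? W x z →-dec (¬? (z ∈? F) →-dec z ≟ y))

⊃-add : ∀ {F : Subset n} {v} → v ∉ F → (F ∪ ⁅ v ⁆) ⊃ F
⊃-add {F = F} {v} v∉F = p⊆p∪q ⁅ v ⁆ , v , q⊆p∪q F ⁅ v ⁆ (x∈⁅x⁆ v) , v∉F

-- Reachability along a decidable relation on Fin n is decidable: a set of
-- reachable vertices is enlarged until it is closed.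
module _ {R : Rel (Fin n) 0ℓ} (R? : Decidable R) where

  private
    saturate : ∀ u (A : Subset n) → Acc _⊃_ A → u ∈ A → (∀ v → v ∈ A → Star R u v) →
               ∃ λ B → ∀ v → v ∈ B ⇔ Star R u v
    saturate u A (acc rec) u∈A sound
      with any? (λ x → any? (λ y → x ∈? A ×-dec ¬? (y ∈? A) ×-dec R? x y))
    ... | yes (x , y , x∈A , y∉A , r) =
      saturate u (A ∪ ⁅ y ⁆) (rec (⊃-add y∉A)) (p⊆p∪q ⁅ y ⁆ u∈A) λ v v∈ →
        [ sound v
        , (λ v∈y → subst (Star R u) (sym (x∈⁅y⁆⇒x≡y y v∈y)) (sound x x∈A ◅◅ r ◅ ε))
        ] (x∈p∪q⁻ A ⁅ y ⁆ v∈)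
    ... | no closed = A , λ v → mk⇔ (sound v) (complete u∈A)
      where
      complete : ∀ {w v} → w ∈ A → Star R w v → v ∈ A
      complete w∈A ε = w∈A
      complete {w} w∈A (_◅_ {j = z} r rs) with z ∈? A
      ... | yes z∈A = complete z∈A rs
      ... | no  z∉A = ⊥-elim (closed (w , z , w∈A , z∉A , r))

  star? : Decidable (Star R)
  star? u v with saturate u ⁅ u ⁆ (⊃-wellFounded _) (x∈⁅x⁆ u)
                   (λ w w∈ → subst (Star R u) (sym (x∈⁅y⁆⇒x≡y u w∈)) ε)
  ... | B , spec = Dec.map (spec v) (v ∈? B)

isComponent? : (G : SimpleGraph n) → ∀ W → Unary.Decidable (IsComponent G W)
isComponent? G W U = any? λ u → u ∈? W ×-dec all? λ v →
  Dec.map′ (λ (f , g) → mk⇔ f g) (λ e → Equivalence.to e , Equivalence.from e)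
    ((v ∈? U →-dec star? (adjIn? G W) u v) ×-dec (star? (adjIn? G W) u v →-dec v ∈? U))

-- Every subset of Fin n, listed once.
subsets : ∀ n → List (Subset n)
subsets zero    = [] ∷ []
subsets (suc n) = map (inside ∷_) (subsets n) ++ map (outside ∷_) (subsets n)

components : SimpleGraph n → Subset n → List (Subset n)
components G W = filter (isComponent? G W) (subsets _)

-- ZWins G t F: from filled set F with t tokens left, the player of the
-- Z-Game can fill all vertices.
data ZWins (G : SimpleGraph n) : ℕ → Subset n → Set where
  done  : ∀ {t F} → (∀ v → v ∈ F) → ZWins G t F
  token : ∀ {t F} v → v ∉ F → ZWins G t (F ∪ ⁅ v ⁆) → ZWins G (suc t) F
  rule  : ∀ {t F F′} → FillIn G ⊤ F F′ → ZWins G t F′ → ZWins G t F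

-- ZqWins G q t F: from filled set F with t tokens left, the player of the
-- Z_q-Game can guarantee, against every oracle, that all vertices become
-- filled.  A selection is a sublist S of the components of G[V∖F], the
-- oracle's answer a nonempty sublist R of S; the answer permits any number
-- of applications (possibly none) of the filling rule in G[F ∪ ⋃ R].
data ZqWins (G : SimpleGraph n) (q : ℕ) : ℕ → Subset n → Set where
  done   : ∀ {t F} → (∀ v → v ∈ F) → ZqWins G q t F
  token  : ∀ {t F} v → v ∉ F → ZqWins G q t (F ∪ ⁅ v ⁆) → ZqWins G q (suc t) F
  rule   : ∀ {t F F′} → FillIn G ⊤ F F′ → ZqWins G q t F′ → ZqWins G q t F
  oracle : ∀ {t F} S → S ⊆ components G (∁ F) → q < length S →
           (∀ R → R ⊆ S → R ≢ [] →
             ∃ λ F′ → Star (FillIn G (F ∪ ⋃ R)) F F′ × ZqWins G q t F′) →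
           ZqWins G q t F

IsMinimum : Pred ℕ 0ℓ → ℕ → Set
IsMinimum P m = P m × (∀ t → P t → m ≤ t)

minimum : {P : Pred ℕ 0ℓ} → Unary.Decidable P → ∃ P → ∃ (IsMinimum P)
minimum {P} P? (b , Pb) = search b P P? Pb
  where
  search : ∀ b (P : Pred ℕ 0ℓ) → Unary.Decidable P → P b → ∃ (IsMinimum P)
  search zero    P P? Pb = 0 , Pb , λ _ _ → z≤n
  search (suc b) P P? Pb with P? 0
  ... | yes P0 = 0 , P0 , λ _ _ → z≤n
  ... | no ¬P0 with search b (P ∘ suc) (P? ∘ suc) Pb
  ...   | m , Pm , least = suc m , Pm , λ { zero P0 → contradiction P0 ¬P0 ; (suc t) Pt → s≤s (least t Pt) }

anySublist? : ∀ {A : Set} {P : Pred (List A) 0ℓ} → Unary.Decidable P →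
              ∀ xs → Dec (∃ λ ys → ys ⊆ xs × P ys)
anySublist? P? [] = Dec.map′ (λ p → [] , [] , p) (λ { ([] , [] , p) → p }) (P? [])
anySublist? P? (x ∷ xs) = Dec.map′
  [ (λ (ys , s , p) → ys , x ∷ʳ s , p) , (λ (ys , s , p) → x ∷ ys , refl ∷ s , p) ]
  (λ { (ys , _ ∷ʳ s , p) → inj₁ (ys , s , p) ; (_ ∷ ys , refl ∷ s , p) → inj₂ (ys , s , p) })
  (anySublist? P? xs ⊎-dec anySublist? (P? ∘ (x ∷_)) xs)

allSublist? : ∀ {A : Set} {P : Pred (List A) 0ℓ} → Unary.Decidable P →
              ∀ xs → Dec (∀ ys → ys ⊆ xs → P ys)
allSublist? P? [] = Dec.map′ (λ { p [] [] → p }) (λ f → f [] []) (P? [])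
allSublist? P? (x ∷ xs) = Dec.map′
  (λ { (f , g) ys (_ ∷ʳ s) → f ys s ; (f , g) (_ ∷ ys) (refl ∷ s) → g ys s })
  (λ f → (λ ys s → f ys (x ∷ʳ s)) , (λ ys s → f (x ∷ ys) (refl ∷ s)))
  (allSublist? P? xs ×-dec allSublist? (P? ∘ (x ∷_)) xs)

nonempty? : ∀ {A : Set} (xs : List A) → Dec (xs ≢ [])
nonempty? []       = no λ f → f refl
nonempty? (x ∷ xs) = yes λ ()

module _ (G : SimpleGraph n) where

  fillIn⊃ : ∀ {W F F′} → FillIn G W F F′ → F′ ⊃ F
  fillIn⊃ (fill x y (_ , _ , y∉F , _)) = ⊃-add y∉F

  -- It suffices to decide P strictly above F, in order to find a P reached
  -- from F by at least one application of the rule.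
  module _ {P : Pred (Subset n) 0ℓ} (W : Subset n) where

    Reach Reach⁺ : Pred (Subset n) 0ℓ
    Reach  F = ∃ λ F′ → Star (FillIn G W) F F′ × P F′
    Reach⁺ F = ∃ λ F′ → FillIn G W F F′ × Reach F′

    reach⁺? : ∀ {F} → Acc _⊃_ F → (∀ {F′} → F′ ⊃ F → Dec (P F′)) → Dec (Reach⁺ F)
    reach⁺? {F} (acc rec) P? = Dec.map′
      (λ { (x , y , f , r) → F ∪ ⁅ y ⁆ , fill x y f , r })
      (λ { (_ , fill x y f , r) → x , y , f , r })
      (any? λ x → any? λ y → step x y)
      where
      step : ∀ x y → Dec (Forces G W F x y × Reach (F ∪ ⁅ y ⁆))
      step x y with forces? G W F x y
      ... | no ¬f = no (¬f ∘ proj₁)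
      ... | yes f@(_ , _ , y∉F , _) = Dec.map′ (f ,_) proj₂ (Dec.map′
        [ (λ p → _ , ε , p) , (λ (_ , s , F″ , ss , p) → F″ , s ◅ ss , p) ]
        (λ { (_ , ε , p) → inj₁ p ; (F″ , s ◅ ss , p) → inj₂ (_ , s , F″ , ss , p) })
        (P? (⊃-add y∉F) ⊎-dec
         reach⁺? (rec (⊃-add y∉F)) (λ gt → P? (⊃-trans gt (⊃-add y∉F)))))
        where
        ⊃-trans : ∀ {A B C : Subset n} → A ⊃ B → B ⊃ C → A ⊃ C
        ⊃-trans (B⊆A , _) (C⊆B , x , x∈B , x∉C) = (B⊆A ∘ C⊆B) , x , B⊆A x∈B , x∉C

  tokenMove? : ∀ {W : ℕ → Pred (Subset n) 0ℓ} {F} → (∀ t {F′} → F′ ⊃ F → Dec (W t F′)) →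
               ∀ t → Dec (∃ λ s → t ≡ suc s × ∃ λ v → v ∉ F × W s (F ∪ ⁅ v ⁆))
  tokenMove? W? zero    = no λ ()
  tokenMove? {W} {F} W? (suc t) = Dec.map′ (λ m → t , refl , m) (λ { (_ , refl , m) → m }) (any? move?)
    where
    move? : ∀ v → Dec (v ∉ F × W t (F ∪ ⁅ v ⁆))
    move? v with v ∈? F
    ... | yes v∈F = no λ (v∉F , _) → v∉F v∈F
    ... | no  v∉F = Dec.map′ (v∉F ,_) proj₂ (W? t (⊃-add v∉F))

  ruleMove? : ∀ {P : Pred (Subset n) 0ℓ} {F} → (∀ {F′} → F′ ⊃ F → Dec (P F′)) →
              Dec (∃ λ F′ → FillIn G ⊤ F F′ × P F′)
  ruleMove? {P} {F} P? = Dec.map′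
    (λ { (x , y , f , p) → F ∪ ⁅ y ⁆ , fill x y f , p })
    (λ { (_ , fill x y f , p) → x , y , f , p })
    (any? λ x → any? λ y → step x y)
    where
    step : ∀ x y → Dec (Forces G ⊤ F x y × P (F ∪ ⁅ y ⁆))
    step x y with forces? G ⊤ F x y
    ... | no ¬f = no (¬f ∘ proj₁)
    ... | yes f@(_ , _ , y∉F , _) = Dec.map′ (f ,_) proj₂ (P? (⊃-add y∉F))

  zWins? : ∀ t F → Acc _⊃_ F → Dec (ZWins G t F)
  zWins? t F (acc rec) = Dec.map′
    [ done , [ (λ { (_ , refl , v , v∉F , w) → token v v∉F w }) , (λ (_ , f , w) → rule f w) ] ]
    (λ { (done all) → inj₁ all
       ; (token v v∉F w) → inj₂ (inj₁ (_ , refl , v , v∉F , w))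
       ; (rule f w) → inj₂ (inj₂ (_ , f , w)) })
    (all? (_∈? F) ⊎-dec tokenMove? (λ s gt → zWins? s _ (rec gt)) t
                  ⊎-dec ruleMove? (λ gt → zWins? t _ (rec gt)))

  -- An oracle move after which some answer fills nothing is redundant, so
  -- moves that fill something against every answer are all that matter.
  module _ (q : ℕ) where

    private
      OracleMove : ℕ → Subset n → List (Subset n) → Set
      OracleMove t F S = q < length S ×
        (∀ R → R ⊆ S → R ≢ [] → Reach⁺ {P = ZqWins G q t} (F ∪ ⋃ R) F)

      Progress : ℕ → Subset n → Set
      Progress t F = (∀ v → v ∈ F)
        ⊎ (∃ λ s → t ≡ suc s × ∃ λ v → v ∉ F × ZqWins G q s (F ∪ ⁅ v ⁆))
        ⊎ (∃ λ F′ → FillIn G ⊤ F F′ × ZqWins G q t F′)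
        ⊎ (∃ λ S → S ⊆ components G (∁ F) × OracleMove t F S)

      fromProgress : ∀ {t F} → Progress t F → ZqWins G q t F
      fromProgress (inj₁ all) = done all
      fromProgress (inj₂ (inj₁ (_ , refl , v , v∉F , w))) = token v v∉F w
      fromProgress (inj₂ (inj₂ (inj₁ (_ , f , w)))) = rule f w
      fromProgress (inj₂ (inj₂ (inj₂ (S , S⊆ , q< , ans)))) = oracle S S⊆ q< λ R R⊆ R≢ →
        let _ , f , F″ , fs , w = ans R R⊆ R≢ in F″ , f ◅ fs , w

      noProgress : ∀ {t F} → ¬ Progress t F → ¬ ZqWins G q t F
      noProgress ¬p (done all) = ¬p (inj₁ all)
      noProgress ¬p (token v v∉F w) = ¬p (inj₂ (inj₁ (_ , refl , v , v∉F , w)))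
      noProgress ¬p (rule f w) = ¬p (inj₂ (inj₂ (inj₁ (_ , f , w))))
      noProgress {t} {F} ¬p (oracle S S⊆ q< ans) =
        ¬p (inj₂ (inj₂ (inj₂ (S , S⊆ , q< , ans⁺))))
        where
        ans⁺ : ∀ R → R ⊆ S → R ≢ [] → Reach⁺ {P = ZqWins G q t} (F ∪ ⋃ R) F
        ans⁺ R R⊆ R≢ with ans R R⊆ R≢
        ... | _ , ε , w = ⊥-elim (noProgress ¬p w)
        ... | F″ , f ◅ fs , w = _ , f , F″ , fs , w

    zqWins? : ∀ t F → Acc _⊃_ F → Dec (ZqWins G q t F)
    zqWins? t F ac@(acc rec) with
      all? (_∈? F)
        ⊎-dec tokenMove? (λ s gt → zqWins? s _ (rec gt)) t
        ⊎-dec ruleMove? (λ gt → zqWins? t _ (rec gt))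
        ⊎-dec anySublist? {P = OracleMove t F} (λ S → q <? length S ×-dec
                allSublist? (λ R → nonempty? R →-dec
                  reach⁺? (F ∪ ⋃ R) (acc rec) (λ gt → zqWins? t _ (rec gt))) S)
                (components G (∁ F))
    ... | yes p = yes (fromProgress p)
    ... | no ¬p = no (noProgress ¬p)

  -- Filling every vertex by tokens wins either game.
  enoughTokens : (W : ℕ → Subset n → Set) →
                 (∀ {t F} → (∀ v → v ∈ F) → W t F) →
                 (∀ {t F} v → v ∉ F → W t (F ∪ ⁅ v ⁆) → W (suc t) F) →
                 ∀ F → Acc _⊃_ F → ∃ λ t → W t F
  enoughTokens W d k F (acc rec) with all? (_∈? F)
  ... | yes all = 0 , d all
  ... | no ¬all with ¬∀⟶∃¬ _ _ (_∈? F) ¬all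
  ...   | v , v∉F with enoughTokens W d k (F ∪ ⁅ v ⁆) (rec (⊃-add v∉F))
  ...     | t , w = suc t , k v v∉F w

  Z-min : ∃ (IsMinimum (λ t → ZWins G t ⊥))
  Z-min = minimum (λ t → zWins? t ⊥ (⊃-wellFounded ⊥))
                  (enoughTokens (ZWins G) done token ⊥ (⊃-wellFounded ⊥))

  Zq-min : ∀ q → ∃ (IsMinimum (λ t → ZqWins G q t ⊥))
  Zq-min q = minimum (λ t → zqWins? q t ⊥ (⊃-wellFounded ⊥))
                     (enoughTokens (ZqWins G q) done token ⊥ (⊃-wellFounded ⊥))

Z : SimpleGraph n → ℕ
Z G = proj₁ (Z-min G)

Z[_] : ℕ → SimpleGraph n → ℕ
Z[ q ] G = proj₁ (Zq-min G q)

{-# OPTIONS --safe #-}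

-- Tokens spent bound the number of active vertices, i.e. filled vertices with
-- an unfilled neighbour: a token creates at most one, and when x forces y the
-- vertex x stops being active.  So if fewer than k + 1 tokens are spent and at
-- least k + 1 components are selected, there are more components than active
-- vertices.  Starting from the whole selection, as long as some x forces some
-- y in G[F ∪ ⋃ R], the oracle drops from R the component of y; this costs one
-- component and leaves x without unfilled neighbours, so components keep
-- outnumbering active vertices.  The answer that remains is nonempty and
-- allows no force at all, hence oracle moves are useless.
module Submission where

open import Defs
open import Data.Empty using (⊥-elim)
open import Data.Fin using (Fin; zero; suc)
open import Data.Fin.Properties using (any?)
open import Data.Fin.Subset
  using (Subset; _∈_; _∉_; _∪_; _-_; _⊂_; ∁; ⊤; ⊥; ⁅_⁆; ⋃; ∣_∣; inside; outside)
open import Data.Fin.Subset.Induction using (⊂-wellFounded)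
open import Data.Fin.Subset.Properties
  using ( _∈?_; ∈⊤; ∉⊥; p⊆p∪q; q⊆p∪q; x∈⁅x⁆; x∈p∪q⁻; ∪-identityʳ; ∣⊥∣≡0
        ; ⊆-antisym; x∈p⇒p-x⊂p; x∈p⇒∣p-x∣<∣p∣; x∈p∧x≢y⇒x∈p-y)
open import Data.List using (List; []; _∷_; filter; length)
open import Data.List.Membership.Propositional.Properties using (∈-map⁻)
open import Data.List.Properties using (filter-all)
open import Data.List.Relation.Binary.Sublist.Propositional
  using (_⊆_; []; _∷_; _∷ʳ_; ⊆-refl; ⊆-trans)
open import Data.List.Relation.Binary.Sublist.Propositional.Properties
  using (All-resp-⊆; Any-resp-⊆; filter-⊆)
open import Data.List.Relation.Unary.All as All using (All; []; _∷_)
open import Data.List.Relation.Unary.All.Properties using (all-filter; All¬⇒¬Any)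
open import Data.List.Relation.Unary.AllPairs using (AllPairs; []; _∷_)
import Data.List.Relation.Unary.AllPairs.Properties as AllPairs
open import Data.List.Relation.Unary.Any using (Any; here; there)
open import Data.List.Relation.Unary.Unique.Propositional using (Unique)
import Data.List.Relation.Unary.Unique.Propositional.Properties as Unique
open import Data.Nat using (ℕ; zero; suc; _+_; _≤_; _<_; z≤n; s≤s; s≤s⁻¹)
open import Data.Nat.Properties
  using (≤-refl; ≤-reflexive; ≤-trans; ≤-antisym; <-≤-trans; ≤-<-trans; +-suc; +-identityʳ; +-monoʳ-≤; m≤n+m; n≤1+n)
open import Data.Product using (∃; _×_; _,_; proj₁; proj₂)
open import Data.Sum using (inj₁; inj₂; [_,_]′)
open import Data.Vec using (_∷_)
open import Data.Vec.Properties using (∷-injectiveʳ)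
open import Function using (_∘_; Equivalence)
open import Induction.WellFounded using (Acc; acc)
open import Level using (0ℓ)
open import Relation.Binary using (Rel)
open import Relation.Binary.Construct.Closure.ReflexiveTransitive using (ε; _◅_; _◅◅_; reverse)
open import Relation.Binary.PropositionalEquality using (_≡_; _≢_; refl; sym; trans; cong; subst)
open import Relation.Nullary using (¬_; yes; no; contradiction)
open import Relation.Nullary.Decidable using (¬?)

private
  variable
    n : ℕ

∣p∪⁅x⁆∣≤1+∣p∣ : ∀ (p : Subset n) x → ∣ p ∪ ⁅ x ⁆ ∣ ≤ suc ∣ p ∣
∣p∪⁅x⁆∣≤1+∣p∣ (inside  ∷ p) zero    rewrite ∪-identityʳ p = n≤1+n _
∣p∪⁅x⁆∣≤1+∣p∣ (outside ∷ p) zero    rewrite ∪-identityʳ p = ≤-refl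
∣p∪⁅x⁆∣≤1+∣p∣ (inside  ∷ p) (suc x) = s≤s (∣p∪⁅x⁆∣≤1+∣p∣ p x)
∣p∪⁅x⁆∣≤1+∣p∣ (outside ∷ p) (suc x) = ∣p∪⁅x⁆∣≤1+∣p∣ p x

∈⋃⁻ : ∀ {x : Fin n} Us → x ∈ ⋃ Us → Any (x ∈_) Us
∈⋃⁻ []       x∈ = contradiction x∈ ∉⊥
∈⋃⁻ (U ∷ Us) x∈ = [ here , there ∘ ∈⋃⁻ Us ]′ (x∈p∪q⁻ U (⋃ Us) x∈)

∈⋃⁺ : ∀ {x : Fin n} {Us} → Any (x ∈_) Us → x ∈ ⋃ Us
∈⋃⁺ {Us = U ∷ Us} (here x∈U)  = p⊆p∪q (⋃ Us) x∈U
∈⋃⁺ {Us = U ∷ Us} (there x∈) = q⊆p∪q U (⋃ Us) (∈⋃⁺ x∈)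

AllPairs-resp-⊆ : ∀ {A : Set} {R : Rel A 0ℓ} {xs ys} → xs ⊆ ys → AllPairs R ys → AllPairs R xs
AllPairs-resp-⊆ []         []       = []
AllPairs-resp-⊆ (_ ∷ʳ s)   (_ ∷ ps) = AllPairs-resp-⊆ s ps
AllPairs-resp-⊆ (refl ∷ s) (p ∷ ps) = All-resp-⊆ s p ∷ AllPairs-resp-⊆ s ps

Disjoint : Rel (Subset n) 0ℓ
Disjoint U V = ∀ x → x ∈ U → x ∉ V

avoiding : Fin n → List (Subset n) → List (Subset n)
avoiding y = filter (λ U → ¬? (y ∈? U))

∉⋃-avoiding : ∀ (y : Fin n) Us → y ∉ ⋃ (avoiding y Us)
∉⋃-avoiding y Us = All¬⇒¬Any (all-filter _ Us) ∘ ∈⋃⁻ (avoiding y Us)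

-- Disjointness puts `y` in at most one set of the list, so once that set is dropped the filter
-- keeps all later ones.
length-avoiding : ∀ (y : Fin n) {Us} → AllPairs Disjoint Us → length Us ≤ suc (length (avoiding y Us))
length-avoiding y [] = z≤n
length-avoiding y {U ∷ Us} (dis ∷ ps) with y ∈? U
... | yes y∈U = s≤s (≤-reflexive (cong length (sym (filter-all _ (All.map (λ d → d y y∈U) dis)))))
... | no  _   = s≤s (length-avoiding y ps)

-- Rules out repeated entries in `components`, which would not be disjoint.
subsets-unique : ∀ n → Unique (subsets n)
subsets-unique zero    = [] ∷ []
subsets-unique (suc n) = Unique.++⁺
  (Unique.map⁺ ∷-injectiveʳ (subsets-unique n))
  (Unique.map⁺ ∷-injectiveʳ (subsets-unique n))
  λ (v∈ , v∈′) → inside≢outside (trans (sym (proj₂ (proj₂ (∈-map⁻ _ v∈)))) (proj₂ (proj₂ (∈-map⁻ _ v∈′))))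
  where
  inside≢outside : ∀ {p q : Subset n} → inside ∷ p ≢ outside ∷ q
  inside≢outside ()

module _ (G : SimpleGraph n) where
  open SimpleGraph G

  -- A shared vertex `x` links the two base points: go from `v` to `x`, back to `u` by symmetry of
  -- adjacency, then on to `w`.
  component-⊆ : ∀ {W U V x w} → IsComponent G W U → IsComponent G W V →
                x ∈ U → x ∈ V → w ∈ U → w ∈ V
  component-⊆ (u , _ , U⇔) (v , _ , V⇔) x∈U x∈V w∈U =
    from (V⇔ _) (to (V⇔ _) x∈V ◅◅ reverse (λ (x∈ , y∈ , xy) → y∈ , x∈ , symmetric xy) (to (U⇔ _) x∈U)
                  ◅◅ to (U⇔ _) w∈U)
    where open Equivalence

  components-disjoint : ∀ W → AllPairs Disjoint (components G W)
  components-disjoint W =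
    distinct⇒disjoint (all-filter (isComponent? G W) (subsets n))
                      (AllPairs.filter⁺ (isComponent? G W) (subsets-unique n))
    where
    distinct⇒disjoint : ∀ {Us} → All (IsComponent G W) Us → Unique Us → AllPairs Disjoint Us
    distinct⇒disjoint []       []       = []
    distinct⇒disjoint (c ∷ cs) (d ∷ ds) =
      All.zipWith
        (λ (c′ , U≢V) x x∈U x∈V → U≢V (⊆-antisym (component-⊆ c c′ x∈U x∈V) (component-⊆ c′ c x∈V x∈U)))
        (cs , d)
      ∷ distinct⇒disjoint cs ds

  -- `F` stays fixed and only the answer shrinks. Since `A` has to cover only filled vertices with
  -- unfilled neighbours inside `⋃ R`, a forcing `x` can leave `A` together with the set containing
  -- `y`.
  stuckAnswer : ∀ F A → Acc _⊂_ A → ∀ R → AllPairs Disjoint R → ∣ A ∣ < length R →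
                (∀ {x z} → x ∈ F → z ∈ ⋃ R → z ∉ F → Adj x z → x ∈ A) →
                ∃ λ R′ → R′ ⊆ R × R′ ≢ [] × (∀ {x y} → ¬ Forces G (F ∪ ⋃ R′) F x y)
  stuckAnswer F A (acc rec) R dis A<R active
    with any? (λ x → any? (λ y → forces? G (F ∪ ⋃ R) F x y))
  ... | no stuck = R , ⊆-refl , (λ { refl → contradiction A<R λ () }) , λ f → stuck (_ , _ , f)
  ... | yes (x , y , x∈F , (x∈W , y∈W , xy) , y∉F , only) =
    let R′ , R′⊆ , rest = stuckAnswer F (A - x) (rec (x∈p⇒p-x⊂p x∈A)) (avoiding y R)
                            (AllPairs.filter⁺ _ dis) A-x<avoiding active′
    in R′ , ⊆-trans R′⊆ (filter-⊆ _ R) , rest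
    where
    ⋃avoiding⊆⋃ : ∀ {z} → z ∈ ⋃ (avoiding y R) → z ∈ ⋃ R
    ⋃avoiding⊆⋃ = ∈⋃⁺ ∘ Any-resp-⊆ (filter-⊆ _ R) ∘ ∈⋃⁻ (avoiding y R)

    x∈A : x ∈ A
    -- Being unfilled, `y` lies in `⋃ R` and witnesses that `x` is active.
    x∈A = [ (λ y∈F → contradiction y∈F y∉F) , (λ y∈⋃ → active x∈F y∈⋃ y∉F xy) ]′ (x∈p∪q⁻ F (⋃ R) y∈W)

    A-x<avoiding : ∣ A - x ∣ < length (avoiding y R)
    A-x<avoiding = <-≤-trans (x∈p⇒∣p-x∣<∣p∣ x∈A) (s≤s⁻¹ (≤-trans A<R (length-avoiding y dis)))

    active′ : ∀ {w z} → w ∈ F → z ∈ ⋃ (avoiding y R) → z ∉ F → Adj w z → w ∈ A - x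
    -- If `w` were `x`, uniqueness of the forced vertex would give `z ≡ y`, yet no remaining set
    -- contains `y`.
    active′ {w} {z} w∈F z∈ z∉F wz = x∈p∧x≢y⇒x∈p-y (active w∈F (⋃avoiding⊆⋃ z∈) z∉F wz) λ { refl →
      ∉⋃-avoiding y R (subst (_∈ ⋃ (avoiding y R)) (only z (x∈W , q⊆p∪q F (⋃ R) (⋃avoiding⊆⋃ z∈) , wz) z∉F) z∈) }

  ZWins⇒ZqWins : ∀ {q t F} → ZWins G t F → ZqWins G q t F
  ZWins⇒ZqWins (done all)      = done all
  ZWins⇒ZqWins (token v v∉F w) = token v v∉F (ZWins⇒ZqWins w)
  ZWins⇒ZqWins (rule f w)      = rule f (ZWins⇒ZqWins w)

  -- An upper bound rather than the exact set of active vertices, so that each move updates `A`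
  -- without recomputing it.
  ActiveIn : Subset n → Subset n → Set
  ActiveIn A F = ∀ {x z} → x ∈ F → z ∉ F → Adj x z → x ∈ A

  ActiveIn-∪⁅⁆ : ∀ {A F v} → ActiveIn A F → ActiveIn (A ∪ ⁅ v ⁆) (F ∪ ⁅ v ⁆)
  ActiveIn-∪⁅⁆ {A} {F} {v} active x∈ z∉ xz =
    [ (λ x∈F → p⊆p∪q ⁅ v ⁆ (active x∈F (z∉ ∘ p⊆p∪q ⁅ v ⁆) xz)) , q⊆p∪q A ⁅ v ⁆ ]′ (x∈p∪q⁻ F ⁅ v ⁆ x∈)

  -- The only unfilled neighbour of `x` was `y`, so `x` is no longer active and `y` can take its
  -- place.
  ActiveIn-force : ∀ {A F x y} → Forces G ⊤ F x y → ActiveIn A F → ActiveIn ((A - x) ∪ ⁅ y ⁆) (F ∪ ⁅ y ⁆)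
  ActiveIn-force {A} {F} {x} {y} (_ , _ , _ , only) active {w} {z} w∈ z∉ wz with x∈p∪q⁻ F ⁅ y ⁆ w∈
  ... | inj₂ w∈y = q⊆p∪q (A - x) ⁅ y ⁆ w∈y
  ... | inj₁ w∈F = p⊆p∪q ⁅ y ⁆ (x∈p∧x≢y⇒x∈p-y (active w∈F z∉F wz) λ { refl →
    z∉ (q⊆p∪q F ⁅ y ⁆ (subst (_∈ ⁅ y ⁆) (sym (only z (∈⊤ , ∈⊤ , wz) z∉F)) (x∈⁅x⁆ y))) })
    where
    z∉F : z ∉ F
    z∉F = z∉ ∘ p⊆p∪q ⁅ y ⁆

  -- The bound `t + ∣ A ∣ ≤ q` is invariant: a token shifts at most one unit from `t` to `∣ A ∣`,
  -- and a force trades `x` for `y`.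
  ZqWins⇒ZWins : ∀ {q t F} A → ActiveIn A F → t + ∣ A ∣ ≤ q → ZqWins G q t F → ZWins G t F
  ZqWins⇒ZWins A active bound (done all) = done all
  ZqWins⇒ZWins A active bound (token {t} v v∉F w) =
    token v v∉F (ZqWins⇒ZWins (A ∪ ⁅ v ⁆) (ActiveIn-∪⁅⁆ active)
      (≤-trans (+-monoʳ-≤ t (∣p∪⁅x⁆∣≤1+∣p∣ A v)) (≤-trans (≤-reflexive (+-suc t ∣ A ∣)) bound)) w)
  ZqWins⇒ZWins {t = t} A active bound (rule r@(fill x y f@(x∈F , (_ , _ , xy) , y∉F , _)) w) =
    rule r (ZqWins⇒ZWins ((A - x) ∪ ⁅ y ⁆) (ActiveIn-force f active)
      (≤-trans (+-monoʳ-≤ t (≤-trans (∣p∪⁅x⁆∣≤1+∣p∣ (A - x) y) (x∈p⇒∣p-x∣<∣p∣ (active x∈F y∉F xy)))) bound) w)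
  ZqWins⇒ZWins {t = t} {F} A active bound (oracle S S⊆ q<S answer)
    with stuckAnswer F A (⊂-wellFounded A) S (AllPairs-resp-⊆ S⊆ (components-disjoint (∁ F)))
           (≤-<-trans (≤-trans (m≤n+m ∣ A ∣ t) bound) q<S) (λ x∈F _ → active x∈F)
  ... | R , R⊆ , R≢[] , stuck with answer R R⊆ R≢[]
  -- Against a stuck answer only the empty run is possible, so the win continues from the same `F`
  -- and the oracle move is deleted.
  ...   | _ , ε , w              = ZqWins⇒ZWins A active bound w
  ...   | _ , fill _ _ f ◅ _ , _ = ⊥-elim (stuck f)

theorem2p2 : (n : ℕ) (G : SimpleGraph n) (k : ℕ) → Z[ k ] G ≤ k → Z[ k ] G ≡ Z G
theorem2p2 n G k Zk≤k = ≤-antisym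
  (Zk-least (Z G) (ZWins⇒ZqWins G Z-wins))
  -- Nothing is filled initially, so `A` starts as `⊥` and the invariant is just the hypothesis on
  -- tokens.
  (Z-least (Z[ k ] G) (ZqWins⇒ZWins G ⊥ (λ x∈⊥ → contradiction x∈⊥ ∉⊥) bound Zk-wins))
  where
  Z-wins   = proj₁ (proj₂ (Z-min G))
  Z-least  = proj₂ (proj₂ (Z-min G))
  Zk-wins  = proj₁ (proj₂ (Zq-min G k))
  Zk-least = proj₂ (proj₂ (Zq-min G k))

  bound : Z[ k ] G + ∣ ⊥ {n} ∣ ≤ k
  bound rewrite ∣⊥∣≡0 n | +-identityʳ (Z[ k ] G) = Zk≤k
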